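{- Let $R$ be a finite commutative ring and let $\Gamma(R,S)=G_R(D)$ be a gcd-graph, where $D=\{\mathcal I_1,\mathcal I_2,\dots,\mathcal I_k\}$ is a set of distinct nonzero principal ideals of $R$. Suppose that $\mathcal I_i=Rx_i$. Then every element $s\in S$ can be written in the form $s=\hat u x_i$ for some $1\le i\le k$ and some $u\in (R/\operatorname{Ann}_R(\mathcal I_i))^\times$, where $\hat u$ is a lift of $u$ in $R^\times$; moreover $u$ is uniquely determined by $s$.
   Context: All rings are associative and unital. For a set $D$ of distinct nonzero principal ideals of $R$, $G_R(D)=\Gamma(R,S)$ is the graph with vertex set $R$ in which $x,y$ are adjacent if and only if $x-y\in S$, where $S=\{s\in R: Rs\in D\}$. For a subset $T\subset R$, $\operatorname{Ann}_R(T)=\{a\in R: at=0\text{ for all }t\in T\}$. -}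

module Defs where

open import Level using (Level; _⊔_; suc)
open import Algebra.Bundles using (CommutativeRing)
open import Algebra.Definitions using (Invertible)
import Algebra.Properties.AbelianGroup as AbelianGroupProperties
import Algebra.Properties.CommutativeSemigroup as CommutativeSemigroupProperties
import Algebra.Properties.Ring as RingProperties
open import Data.Fin.Base using (Fin)
open import Data.Nat.Base using (ℕ)
open import Data.Product.Base using (_×_; _,_; ∃-syntax)
open import Function.Bundles using (Inverse)
open import Relation.Binary.Core using (Rel)
open import Relation.Binary.Definitions using (_Respects_)
open import Relation.Binary.PropositionalEquality.Core using (_≢_)
open import Relation.Binary.PropositionalEquality.Properties using (setoid)
import Relation.Binary.Reasoning.Setoid as SetoidReasoning
open import Relation.Nullary.Negation.Core using (¬_)
open import Relation.Unary using (Pred; _∈_; _≐_)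

private
  variable
    c ℓ p q : Level

Finite : CommutativeRing c ℓ → Set (c ⊔ ℓ)
Finite R = ∃[ n ] Inverse (CommutativeRing.setoid R) (setoid (Fin n))

record Unit (R : CommutativeRing c ℓ) : Set (c ⊔ ℓ) where
  open CommutativeRing R
  field
    value      : Carrier
    invertible : Invertible _≈_ 1# _*_ value

-- Closure under negation follows from *-closed with the scalar - 1#.
record Ideal (R : CommutativeRing c ℓ) (p : Level) : Set (c ⊔ ℓ ⊔ suc p) where
  open CommutativeRing R
  field
    member   : Pred Carrier p
    resp     : member Respects _≈_
    0-closed : 0# ∈ member
    +-closed : ∀ {a b} → a ∈ member → b ∈ member → (a + b) ∈ member
    *-closed : ∀ r {a} → a ∈ member → (r * a) ∈ member

open Ideal using (member)

module _ (R : CommutativeRing c ℓ) where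
  open CommutativeRing R
  open SetoidReasoning (CommutativeRing.setoid R)

  -- R / I has the carrier of R, with x and y identified when x - y ∈ I;
  -- the projection R → R / I is thus the identity on carriers.
  _/_ : Ideal R p → CommutativeRing c p
  _/_ {p} I = record
    { Carrier = Carrier
    ; _≈_     = _∼_
    ; _+_     = _+_
    ; _*_     = _*_
    ; -_      = -_
    ; 0#      = 0#
    ; 1#      = 1#
    ; isCommutativeRing = record
      { isRing = record
        { +-isAbelianGroup = record
          { isGroup = record
            { isMonoid = record
              { isSemigroup = record
                { isMagma = record
                  { isEquivalence = record { refl = ≈⇒∼ refl ; sym = ∼-sym ; trans = ∼-trans }
                  ; ∙-cong        = +-cong-∼
                  }
                ; assoc = λ x y z → ≈⇒∼ (+-assoc x y z)
                }
              ; identity = (λ x → ≈⇒∼ (+-identityˡ x)) , (λ x → ≈⇒∼ (+-identityʳ x))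
              }
            ; inverse = (λ x → ≈⇒∼ (-‿inverseˡ x)) , (λ x → ≈⇒∼ (-‿inverseʳ x))
            ; ⁻¹-cong = -‿cong-∼
            }
          ; comm = λ x y → ≈⇒∼ (+-comm x y)
          }
        ; *-cong     = *-cong-∼
        ; *-assoc    = λ x y z → ≈⇒∼ (*-assoc x y z)
        ; *-identity = (λ x → ≈⇒∼ (*-identityˡ x)) , (λ x → ≈⇒∼ (*-identityʳ x))
        ; distrib    = (λ x y z → ≈⇒∼ (distribˡ x y z)) , (λ x y z → ≈⇒∼ (distribʳ x y z))
        }
      ; *-comm = λ x y → ≈⇒∼ (*-comm x y)
      }
    }
    where
    open Ideal I hiding (member)
    open RingProperties ring using (-1*x≈-x; x[y-z]≈xy-xz)
    open AbelianGroupProperties +-abelianGroup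
      using (⁻¹-anti-homo‿-) renaming (⁻¹-∙-comm to -‿+-comm)
    open CommutativeSemigroupProperties +-commutativeSemigroup using (interchange)

    _∼_ : Rel Carrier p
    x ∼ y = (x - y) ∈ member I

    ≈⇒∼ : ∀ {x y} → x ≈ y → x ∼ y
    ≈⇒∼ {x} {y} x≈y = resp (sym (trans (+-congʳ x≈y) (-‿inverseʳ y))) 0-closed

    -‿closed : ∀ {a} → a ∈ member I → (- a) ∈ member I
    -‿closed {a} a∈I = resp (-1*x≈-x a) (*-closed (- 1#) a∈I)

    -‿cong-∼ : ∀ {x y} → x ∼ y → (- x) ∼ (- y)
    -‿cong-∼ {x} {y} x∼y = resp (sym (-‿+-comm x (- y))) (-‿closed x∼y)

    ∼-sym : ∀ {x y} → x ∼ y → y ∼ x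
    ∼-sym {x} {y} x∼y = resp (⁻¹-anti-homo‿- x y) (-‿closed x∼y)

    ∼-trans : ∀ {x y z} → x ∼ y → y ∼ z → x ∼ z
    ∼-trans {x} {y} {z} x∼y y∼z = resp eq (+-closed x∼y y∼z)
      where
      eq : (x - y) + (y - z) ≈ x - z
      eq = begin
        (x - y) + (y - z)    ≈⟨ +-assoc x (- y) (y - z) ⟩
        x + (- y + (y - z))  ≈⟨ +-congˡ (+-assoc (- y) y (- z)) ⟨
        x + ((- y + y) - z)  ≈⟨ +-congˡ (+-congʳ (-‿inverseˡ y)) ⟩
        x + (0# - z)         ≈⟨ +-congˡ (+-identityˡ (- z)) ⟩
        x - z                ∎

    +-cong-∼ : ∀ {x y u v} → x ∼ y → u ∼ v → (x + u) ∼ (y + v)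
    +-cong-∼ {x} {y} {u} {v} x∼y u∼v =
      resp (trans (interchange x (- y) u (- v)) (+-congˡ (-‿+-comm y v))) (+-closed x∼y u∼v)

    *-congˡ-∼ : ∀ r {x y} → x ∼ y → (r * x) ∼ (r * y)
    *-congˡ-∼ r {x} {y} x∼y = resp (x[y-z]≈xy-xz r x y) (*-closed r x∼y)

    *-cong-∼ : ∀ {x y u v} → x ∼ y → u ∼ v → (x * u) ∼ (y * v)
    *-cong-∼ {x} {y} {u} {v} x∼y u∼v =
      ∼-trans (≈⇒∼ (*-comm x u))
        (∼-trans (*-congˡ-∼ u x∼y)
          (∼-trans (≈⇒∼ (*-comm u y)) (*-congˡ-∼ y u∼v)))

module _ {R : CommutativeRing c ℓ} where
  open CommutativeRing R

  infix 4 _≐ᴵ_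

  _≐ᴵ_ : Ideal R p → Ideal R q → Set (c ⊔ p ⊔ q)
  I ≐ᴵ J = member I ≐ member J

  ⟨_⟩ : Carrier → Ideal R (c ⊔ ℓ)
  ⟨ a ⟩ = record
    { member   = λ b → ∃[ r ] r * a ≈ b
    ; resp     = λ b≈b′ (r , ra≈b) → r , trans ra≈b b≈b′
    ; 0-closed = 0# , zeroˡ a
    ; +-closed = λ (r , ra≈b) (s , sa≈b′) → r + s , trans (distribʳ a r s) (+-cong ra≈b sa≈b′)
    ; *-closed = λ t (r , ra≈b) → t * r , trans (*-assoc t r a) (*-congˡ ra≈b)
    }

  IsLift : (I : Ideal R p) → Unit R → Unit (R / I) → Set p
  IsLift I û u = Unit.value û ≈ᴵ Unit.value u
    where open CommutativeRing (R / I) using () renaming (_≈_ to _≈ᴵ_)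

module _ (R : CommutativeRing c ℓ) where
  open CommutativeRing R

  Ann : Pred Carrier p → Ideal R (c ⊔ ℓ ⊔ p)
  Ann T = record
    { member   = λ a → ∀ {t} → t ∈ T → a * t ≈ 0#
    ; resp     = λ a≈b aT≈0 t∈T → trans (*-congʳ (sym a≈b)) (aT≈0 t∈T)
    ; 0-closed = λ {t} _ → zeroˡ t
    ; +-closed = λ {a} {b} aT≈0 bT≈0 {t} t∈T →
        trans (distribʳ t a b) (trans (+-cong (aT≈0 t∈T) (bT≈0 t∈T)) (+-identityˡ 0#))
    ; *-closed = λ r {a} aT≈0 {t} t∈T →
        trans (*-assoc r a t) (trans (*-congˡ (aT≈0 t∈T)) (zeroʳ r))
    }

  Γ : Pred Carrier p → Rel Carrier p
  Γ S x y = (x - y) ∈ S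

-- A gcd-graph G_R(D) on R, where D = {𝓘 0, …, 𝓘 (k - 1)}.
record GcdGraph (R : CommutativeRing c ℓ) (p : Level) : Set (c ⊔ ℓ ⊔ suc p) where
  open CommutativeRing R
  field
    k         : ℕ
    𝓘         : Fin k → Ideal R p
    principal : ∀ i → ∃[ a ] 𝓘 i ≐ᴵ ⟨ a ⟩
    nonzero   : ∀ i → ¬ (𝓘 i ≐ᴵ ⟨ 0# ⟩)
    distinct  : ∀ {i j} → i ≢ j → ¬ (𝓘 i ≐ᴵ 𝓘 j)

  S : Pred Carrier (c ⊔ ℓ ⊔ p)
  S s = ∃[ i ] ⟨ s ⟩ ≐ᴵ 𝓘 i

  Adjacent : Rel Carrier (c ⊔ ℓ ⊔ p)
  Adjacent = Γ R S

{-# OPTIONS --safe #-}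

-- If s = a x and x = b s, then a is invertible modulo Ann(x).  Finiteness provides an idempotent
-- power e = aⁿ with n ≥ 1.  As a acts invertibly on x, so does e, whence e x = x; therefore
-- a e + (1 - e), which is a unit with inverse aⁿ⁻¹ e + (1 - e), also carries x to s.
module Submission where

open import Defs
open import Level using (Level)
open import Algebra.Bundles using (CommutativeRing)
open import Data.Fin.Base using (Fin)
open import Data.Product.Base using (_×_; Σ-syntax)
open import Relation.Binary.PropositionalEquality.Core using (_≡_)
open import Relation.Unary using (_∈_)

import Algebra.Properties.AbelianGroup as AbelianGroupProperties
import Algebra.Properties.CommutativeSemigroup as CommutativeSemigroupProperties
import Algebra.Properties.CommutativeSemiring.Exp as CommutativeSemiringExp
import Algebra.Properties.Ring as RingProperties
import Data.Fin.Base as Fin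
open import Data.Fin.Properties using (_≟_; pigeonhole)
open import Data.Nat.Base as ℕ using (zero; suc)
import Data.Nat.Properties as ℕ
open import Data.Product.Base using (_,_; proj₁; proj₂; ∃-syntax)
open import Function.Bundles using (module Injection; module Inverse)
open import Function.Properties.Inverse using (Inverse⇒Injection)
import Relation.Binary.PropositionalEquality as ≡
import Relation.Binary.Reasoning.Setoid as SetoidReasoning
open import Relation.Nullary.Decidable.Core using (decidable-stable)
open import Relation.Unary.Properties using (≐-sym; ≐-trans)

module _ {c ℓ : Level} (R : CommutativeRing c ℓ) where
  open CommutativeRing R
  open CommutativeSemiringExp commutativeSemiring
  open CommutativeSemigroupProperties *-commutativeSemigroup using (x∙yz≈y∙xz)
  open AbelianGroupProperties +-abelianGroup using () renaming (x≈y⇒x∙y⁻¹≈ε to x≈y⇒x-y≈0)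
  open RingProperties ring using (-0#≈0#; [y-z]x≈yx-zx)
  open SetoidReasoning setoid

  -- The `n + 1` powers with exponents `0` to `n` take at most `n` values, so two of them agree.
  -- Their exponents differ, which makes the period positive; hence the form `suc d`.
  ^-eventually-periodic : Finite R → ∀ a → ∃[ i ] ∃[ d ] a ^ (suc d ℕ.+ i) ≈ a ^ i
  ^-eventually-periodic (n , R↔Fin) a
    with i , j , i<j , eq ← pigeonhole (ℕ.n<1+n n) (λ k → Inverse.to R↔Fin (a ^ Fin.toℕ k))
    = Fin.toℕ i , Fin.toℕ j ℕ.∸ suc (Fin.toℕ i) , (begin
        a ^ (suc (Fin.toℕ j ℕ.∸ suc (Fin.toℕ i)) ℕ.+ Fin.toℕ i)
          ≡⟨ ≡.cong (a ^_) (≡.trans (≡.sym (ℕ.+-suc _ (Fin.toℕ i))) (ℕ.m∸n+n≡m i<j)) ⟩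
        a ^ Fin.toℕ j
          ≈⟨ Injection.injective (Inverse⇒Injection R↔Fin) eq ⟨
        a ^ Fin.toℕ i ∎)

  -- Induction on `m`: one factor `a ^ d` is split off, and after the induction hypothesis it moves
  -- past `a ^ k` and is absorbed by `a ^ i`. The shift `k` lets the result apply at any exponent
  -- from `i` onwards.
  ^-period-multiple : ∀ a d i → a ^ (d ℕ.+ i) ≈ a ^ i →
                      ∀ m k → a ^ (m ℕ.* d ℕ.+ (k ℕ.+ i)) ≈ a ^ (k ℕ.+ i)
  ^-period-multiple a d i per zero    k = refl
  ^-period-multiple a d i per (suc m) k = begin
    a ^ (d ℕ.+ m ℕ.* d ℕ.+ (k ℕ.+ i))    ≡⟨ ≡.cong (a ^_) (ℕ.+-assoc d _ _) ⟩
    a ^ (d ℕ.+ (m ℕ.* d ℕ.+ (k ℕ.+ i)))  ≈⟨ ^-homo-* a d _ ⟩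
    a ^ d * a ^ (m ℕ.* d ℕ.+ (k ℕ.+ i))  ≈⟨ *-congˡ (^-period-multiple a d i per m k) ⟩
    a ^ d * a ^ (k ℕ.+ i)                ≈⟨ *-congˡ (^-homo-* a k i) ⟩
    a ^ d * (a ^ k * a ^ i)              ≈⟨ x∙yz≈y∙xz _ _ _ ⟩
    a ^ k * (a ^ d * a ^ i)              ≈⟨ *-congˡ (^-homo-* a d i) ⟨
    a ^ k * a ^ (d ℕ.+ i)                ≈⟨ *-congˡ per ⟩
    a ^ k * a ^ i                        ≈⟨ ^-homo-* a k i ⟨
    a ^ (k ℕ.+ i)                        ∎

  -- With period suc d from i onwards, the exponent (i + 1)(d + 1) is a multiple of the period
  -- that is at least i.
  idempotent-power : Finite R → ∀ a → ∃[ n ] a ^ suc n * a ^ suc n ≈ a ^ suc n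
  idempotent-power finite a
    with i , d , per ← ^-eventually-periodic finite a
    = ℕ.pred N , (begin
        a ^ N * a ^ N                                ≈⟨ ^-homo-* a N N ⟨
        a ^ (N ℕ.+ N)                                ≡⟨ ≡.cong (λ m → a ^ (N ℕ.+ m)) N-i+i≡N ⟨
        a ^ (N ℕ.+ (N ℕ.∸ i ℕ.+ i))                  ≈⟨ ^-period-multiple a (suc d) i per (suc i) _ ⟩
        a ^ (N ℕ.∸ i ℕ.+ i)                          ≡⟨ ≡.cong (a ^_) N-i+i≡N ⟩
        a ^ N                                        ∎)
    where
    N = suc i ℕ.* suc d
    N-i+i≡N : N ℕ.∸ i ℕ.+ i ≡ N
    N-i+i≡N = ℕ.m∸n+n≡m (ℕ.≤-trans (ℕ.n≤1+n i) (ℕ.m≤m*n (suc i) (suc d)))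

  ^-fixes : ∀ {a x} → a * x ≈ x → ∀ n → a ^ n * x ≈ x
  ^-fixes {a} {x} ax≈x zero    = *-identityˡ x
  ^-fixes {a} {x} ax≈x (suc n) =
    trans (*-assoc a (a ^ n) x) (trans (*-congˡ (^-fixes ax≈x n)) ax≈x)

  -- The hypothesis puts `x` in the image of multiplication by `e`, and an idempotent acts as the
  -- identity on its image.
  idempotent-fixes : ∀ {e f x} → e * e ≈ e → (f * e) * x ≈ x → e * x ≈ x
  idempotent-fixes {e} {f} {x} ee≈e fex≈x = begin
    e * x              ≈⟨ *-congˡ fex≈x ⟨
    e * ((f * e) * x)  ≈⟨ *-assoc e (f * e) x ⟨
    (e * (f * e)) * x  ≈⟨ *-congʳ (x∙yz≈y∙xz e f e) ⟩
    (f * (e * e)) * x  ≈⟨ *-congʳ (*-congˡ ee≈e) ⟩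
    (f * e) * x        ≈⟨ fex≈x ⟩
    x                  ∎

  module _ {e : Carrier} (ee≈e : e * e ≈ e) where

    -- The idempotent splits R as `eR × (1 - e)R`. This is the element that acts as `a` on the first
    -- factor and as the identity on the second.
    extend : Carrier → Carrier
    extend a = a * e + (1# - e)

    [1-e]x≈0 : ∀ {x} → e * x ≈ x → (1# - e) * x ≈ 0#
    [1-e]x≈0 {x} ex≈x =
      trans ([y-z]x≈yx-zx x 1# e) (x≈y⇒x-y≈0 (trans (*-identityˡ x) (sym ex≈x)))

    extend-*-fixed : ∀ a {x} → e * x ≈ x → extend a * x ≈ a * x
    extend-*-fixed a {x} ex≈x = begin
      (a * e + (1# - e)) * x        ≈⟨ distribʳ x (a * e) (1# - e) ⟩
      (a * e) * x + (1# - e) * x    ≈⟨ +-cong (*-assoc a e x) ([1-e]x≈0 ex≈x) ⟩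
      a * (e * x) + 0#              ≈⟨ +-identityʳ _ ⟩
      a * (e * x)                   ≈⟨ *-congˡ ex≈x ⟩
      a * x                         ∎

    extend-*-killed : ∀ a {y} → e * y ≈ 0# → extend a * y ≈ y
    extend-*-killed a {y} ey≈0 = begin
      (a * e + (1# - e)) * y          ≈⟨ distribʳ y (a * e) (1# - e) ⟩
      (a * e) * y + (1# - e) * y      ≈⟨ +-cong (*-assoc a e y) ([y-z]x≈yx-zx y 1# e) ⟩
      a * (e * y) + (1# * y - e * y)  ≈⟨ +-cong (*-congˡ ey≈0) (+-cong (*-identityˡ y) (-‿cong ey≈0)) ⟩
      a * 0# + (y - 0#)               ≈⟨ +-cong (zeroʳ a) (+-congˡ -0#≈0#) ⟩
      0# + (y + 0#)                   ≈⟨ trans (+-identityˡ _) (+-identityʳ y) ⟩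
      y                               ∎

    -- Componentwise in the splitting: the part `b * e` of `extend b` lies in the first factor and
    -- is multiplied by `a`, giving `e`; the part `1 - e` lies in the second and is left alone.
    extend-* : ∀ {a b} → a * b ≈ e → extend a * extend b ≈ 1#
    extend-* {a} {b} ab≈e = begin
      extend a * (b * e + (1# - e))             ≈⟨ distribˡ _ _ _ ⟩
      extend a * (b * e) + extend a * (1# - e)  ≈⟨ +-cong (extend-*-fixed a ebe≈be) (extend-*-killed a e[1-e]≈0) ⟩
      a * (b * e) + (1# - e)                    ≈⟨ +-congʳ (*-assoc a b e) ⟨
      (a * b) * e + (1# - e)                    ≈⟨ +-congʳ (trans (*-congʳ ab≈e) ee≈e) ⟩
      e + (1# - e)                              ≈⟨ +-comm e (1# - e) ⟩
      (1# - e) + e                              ≈⟨ +-assoc 1# (- e) e ⟩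
      1# + (- e + e)                            ≈⟨ +-congˡ (-‿inverseˡ e) ⟩
      1# + 0#                                   ≈⟨ +-identityʳ 1# ⟩
      1#                                        ∎
      where
      ebe≈be : e * (b * e) ≈ b * e
      ebe≈be = trans (x∙yz≈y∙xz e b e) (*-congˡ ee≈e)
      e[1-e]≈0 : e * (1# - e) ≈ 0#
      e[1-e]≈0 = trans (*-comm e (1# - e)) ([1-e]x≈0 ee≈e)

    extendUnit : ∀ {a b} → a * b ≈ e → Unit R
    extendUnit {a} {b} ab≈e = record
      { value      = extend a
      ; invertible = extend b , extend-* (trans (*-comm b a) ab≈e) , extend-* ab≈e
      }

  associates-differ-by-unit : Finite R → ∀ {x s} → x ∈ Ideal.member (⟨_⟩ {R = R} s) →
                              s ∈ Ideal.member (⟨_⟩ {R = R} x) →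
                              Σ[ û ∈ Unit R ] s ≈ Unit.value û * x
  associates-differ-by-unit finite {x} {s} (b , bs≈x) (a , ax≈s)
    with n , ee≈e ← idempotent-power finite a
    -- `refl` suffices because `a ^ suc n` unfolds to `a * a ^ n`, so `a ^ n` serves as the partner
    -- of `a`. This is where a positive exponent matters.
    = extendUnit ee≈e refl , sym (trans (extend-*-fixed ee≈e a ex≈x) ax≈s)
    where
    bax≈x : (b * a) * x ≈ x
    bax≈x = trans (*-assoc b a x) (trans (*-congˡ ax≈s) bs≈x)
    ex≈x : a ^ suc n * x ≈ x
    -- Since `b * a` fixes `x`, so does its power, which factors as `b ^ suc n` times the
    -- idempotent.
    ex≈x = idempotent-fixes ee≈e
      (trans (*-congʳ (sym (^-distrib-* b a (suc n)))) (^-fixes bax≈x (suc n)))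

  -- The inverse of the unit carries `s` back to `x`. This serves the uniqueness of the index: a
  -- representation of `s` through a generator determines the ideal of `s`.
  ⟨⟩-unit-multiple : ∀ (û : Unit R) {x s} → s ≈ Unit.value û * x →
                     _≐ᴵ_ {R = R} ⟨ s ⟩ ⟨ x ⟩
  ⟨⟩-unit-multiple û {x} {s} s≈ûx
    with w , wû≈1 , _ ← Unit.invertible û
    = (λ (r , rs≈t) → r * Unit.value û , trans (*-assoc r _ x) (trans (*-congˡ (sym s≈ûx)) rs≈t))
    , (λ (r , rx≈t) → r * w , trans (*-assoc r w s) (trans (*-congˡ ws≈x) rx≈t))
    where
    ws≈x : w * s ≈ x
    ws≈x = begin
      w * s                     ≈⟨ *-congˡ s≈ûx ⟩
      w * (Unit.value û * x)    ≈⟨ *-assoc w _ x ⟨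
      (w * Unit.value û) * x    ≈⟨ *-congʳ wû≈1 ⟩
      1# * x                    ≈⟨ *-identityˡ x ⟩
      x                         ∎

  generator∈ : ∀ a → a ∈ Ideal.member (⟨_⟩ {R = R} a)
  generator∈ a = 1# , *-identityˡ a

  module _ {p} (I : Ideal R p) where

    ≈⇒≈/ : ∀ {a b} → a ≈ b → CommutativeRing._≈_ (R / I) a b
    ≈⇒≈/ a≈b = Ideal.resp I (sym (x≈y⇒x-y≈0 a≈b)) (Ideal.0-closed I)

    reduceUnit : Unit R → Unit (R / I)
    reduceUnit û = record
      { value      = Unit.value û
      ; invertible = let w , wû≈1 , ûw≈1 = Unit.invertible û
                     in w , ≈⇒≈/ wû≈1 , ≈⇒≈/ ûw≈1
      }

  -- Every element of `I` is a multiple of `x`, so `a - b` annihilates `I` as soon as it annihilates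
  -- `x`.
  *-cancelʳ-mod-Ann : ∀ {p} (I : Ideal R p) {x} → _≐ᴵ_ {R = R} I ⟨ x ⟩ →
                      ∀ {a b} → a * x ≈ b * x →
                      CommutativeRing._≈_ (R / Ann R (Ideal.member I)) a b
  *-cancelʳ-mod-Ann I {x} (I⊆⟨x⟩ , _) {a} {b} ax≈bx {t} t∈I
    with r , rx≈t ← I⊆⟨x⟩ t∈I = begin
    (a - b) * t        ≈⟨ *-congˡ rx≈t ⟨
    (a - b) * (r * x)  ≈⟨ x∙yz≈y∙xz (a - b) r x ⟩
    r * ((a - b) * x)  ≈⟨ *-congˡ (trans ([y-z]x≈yx-zx x a b) (x≈y⇒x-y≈0 ax≈bx)) ⟩
    r * 0#             ≈⟨ zeroʳ r ⟩
    0#                 ∎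

corollary2p7 :
    ∀ {c ℓ p : Level} (R : CommutativeRing c ℓ) → Finite R →
    (G : GcdGraph R p) →
    let open CommutativeRing R
        open GcdGraph G
        Annᴵ   = λ (i : Fin k) → Ann R (Ideal.member (𝓘 i))
        Unitᴵ  = λ (i : Fin k) → Unit (R / Annᴵ i)
    in
    (x : Fin k → Carrier) → (∀ i → 𝓘 i ≐ᴵ ⟨ x i ⟩) →
    let Represents = λ (i : Fin k) (u : Unitᴵ i) (s : Carrier) →
          Σ[ û ∈ Unit R ] IsLift (Annᴵ i) û u × s ≈ Unit.value û * x i
    in
    ∀ s → s ∈ S →
    Σ[ i ∈ Fin k ] Σ[ u ∈ Unitᴵ i ]
      Represents i u s
      × (∀ j (v : Unitᴵ j) → Represents j v s → j ≡ i)
      × (∀ (v : Unitᴵ i) → Represents i v s →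
           CommutativeRing._≈_ (R / Annᴵ i) (Unit.value v) (Unit.value u))
corollary2p7 R finite G x 𝓘≐⟨x⟩ s (i , ⟨s⟩≐𝓘i)
  -- Both `s` and `x i` generate `𝓘 i`, so each is a multiple of the other.
  with û , s≈ûx ← associates-differ-by-unit R finite
         (proj₂ (≐-trans ⟨s⟩≐𝓘i (𝓘≐⟨x⟩ i)) (generator∈ R (x i)))
         (proj₁ (≐-trans ⟨s⟩≐𝓘i (𝓘≐⟨x⟩ i)) (generator∈ R s))
  -- Reduction keeps the underlying element, so the lift condition is reflexivity in the quotient.
  = i , reduceUnit R Annᵢ û , (û , R/Annᵢ.refl , s≈ûx)
  -- A representation at `j` gives `𝓘 j = ⟨ s ⟩ = 𝓘 i`. Distinctness only refutes `j ≢ i`; decidable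
  -- equality on `Fin k` turns this into `j ≡ i`.
  , (λ j _ (v̂ , _ , s≈v̂x) → decidable-stable (j ≟ i) λ j≢i →
       distinct j≢i (≐-trans (𝓘≐⟨x⟩ j) (≐-trans (≐-sym (⟨⟩-unit-multiple R v̂ s≈v̂x)) ⟨s⟩≐𝓘i)))
  -- Both lifts send `x i` to `s`, so they agree modulo the annihilator, and `v` agrees there with
  -- its lift.
  , λ v (v̂ , v̂≈v , s≈v̂x) → R/Annᵢ.trans (R/Annᵢ.sym v̂≈v)
       (*-cancelʳ-mod-Ann R (𝓘 i) (𝓘≐⟨x⟩ i) (R.trans (R.sym s≈v̂x) s≈ûx))
  where
  open GcdGraph G
  module R = CommutativeRing R
  Annᵢ = Ann R (Ideal.member (𝓘 i))
  module R/Annᵢ = CommutativeRing (R / Annᵢ)
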